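{- Let $G$ be a connected graph with at least two vertices. Then $\mathrm{mpd}(G)\ge 4$ (where the inequality is regarded as true if $\mathrm{mpd}(G)=\infty$).
   Context: Graphs are finite, simple and undirected; $d(u,v)$ denotes the shortest-path distance. Let $G$ be a connected graph and let $\Pi=\{S_1,\dots,S_t\}$ be a partition of $V(G)$ into nonempty parts. For $v\in V(G)$ put $d(v,S_i)=\min\{d(v,x):x\in S_i\}$. The multiset partition representation of $v$ with respect to $\Pi$ is the multiset $r_{mp}(v\mid\Pi)=\{d(v,S_1),\dots,d(v,S_t)\}$ (order ignored, multiplicities kept). $\Pi$ is a resolving multiset partition if $r_{mp}(u\mid\Pi)\ne r_{mp}(v\mid\Pi)$ for all distinct $u,v\in V(G)$. The multiset partition dimension $\mathrm{mpd}(G)$ is the minimum number $t$ of parts of a resolving multiset partition of $G$, and $\mathrm{mpd}(G)=\infty$ if none exists. -}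

module Defs where

open import Data.Fin using (Fin; zero; suc; toℕ; fromℕ<; _≟_)
open import Data.Fin.Properties using (any?; all?; injective⇒≤; toℕ-fromℕ<)
open import Data.Fin.Subset using (Subset; _∈_; Nonempty)
open import Data.Fin.Subset.Properties using (_∈?_; nonempty?; anySubset?)
open import Data.List using (List; tabulate)
open import Data.List.Properties using (tabulate-cong)
open import Data.List.Relation.Binary.Permutation.Propositional
  using (_↭_; ↭-sym; ↭-trans; ↭-reflexive; ↭⇒↭ₛ)
open import Data.List.Relation.Binary.Pointwise using (Pointwise-≡⇒≡)
import Data.List.Properties as List
import Data.List.Relation.Unary.Sorted.TotalOrder.Properties as Sorted
import Data.List.Sort as Sort
open import Data.Nat as ℕ using (ℕ; zero; suc; _≤_; z≤n; s≤s)
import Data.Nat.Properties as ℕ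
open import Data.Product using (Σ; ∃; _×_; _,_; proj₁; proj₂)
open import Data.Vec as Vec using (Vec; []; _∷_; head; last; lookup)
open import Data.Vec.Relation.Unary.AllPairs using (allPairs?)
open import Data.Vec.Relation.Unary.Linked using (Linked; linked?)
open import Data.Vec.Relation.Unary.Unique.Propositional using (Unique)
open import Function using (_∘_)
open import Level using (0ℓ)
open import Relation.Binary as B using (Rel; Symmetric; Irreflexive)
open import Relation.Binary.PropositionalEquality
  using (_≡_; _≢_; refl; sym; subst)
open import Relation.Nullary using (¬_; Dec; yes; no; contradiction)
open import Relation.Nullary.Decidable using (map′; ¬?; _×-dec_; _→-dec_)
open import Relation.Unary using (Pred; Decidable)

open import Relation.Nullary.Construct.Add.Supremum public using (_⁺; ⊤⁺; [_])
-- ℕ ⁺ is ℕ ∪ {∞}, with ⊤⁺ for ∞ and _≤⁺_ its order.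
open import Relation.Binary.Construct.Add.Supremum.NonStrict _≤_ public
  using (_≤⁺_; [_]; _≤⊤⁺)

IsMinimum : Pred ℕ 0ℓ → ℕ → Set
IsMinimum P m = P m × (∀ j → P j → m ≤ j)

least-from : {P : Pred ℕ 0ℓ} → Decidable P → ∀ k → P k → ∃ (IsMinimum P)
least-from P? k pk with P? zero
least-from P? k       pk | yes p₀ = zero , p₀ , λ _ _ → z≤n
least-from P? zero    pk | no ¬p₀ = contradiction pk ¬p₀
least-from P? (suc k) pk | no ¬p₀ with least-from (P? ∘ suc) k pk
... | m , pm , m≤ = suc m , pm ,
  λ { zero    p₀ → contradiction p₀ ¬p₀
    ; (suc j) pj → s≤s (m≤ j pj) }

least : {P : Pred ℕ 0ℓ} → Decidable P → ∃ P → ∃ (IsMinimum P)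
least P? (k , pk) = least-from P? k pk

minimum : {P : Pred ℕ 0ℓ} → Decidable P → ∃ P → ℕ
minimum P? e = proj₁ (least P? e)

minimum-isMinimum : {P : Pred ℕ 0ℓ} (P? : Decidable P) (e : ∃ P) →
                    IsMinimum P (minimum P? e)
minimum-isMinimum P? e = proj₂ (least P? e)

-- The value does not depend on the witness of inhabitation.
minimum-irrelevant : {P : Pred ℕ 0ℓ} (P? : Decidable P) (e e′ : ∃ P) →
                     minimum P? e ≡ minimum P? e′
minimum-irrelevant P? e e′ with least P? e | least P? e′
... | m , pm , m≤ | m′ , pm′ , m′≤ = ℕ.≤-antisym (m≤ m′ pm′) (m′≤ m pm)

Searchable : Set → Set₁
Searchable A = {P : Pred A 0ℓ} → Decidable P → Dec (∃ P)

anyVec? : {A : Set} → Searchable A → ∀ m → Searchable (Vec A m)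
anyVec? any zero    P? = map′ ([] ,_) (λ { ([] , p) → p }) (P? [])
anyVec? any (suc m) P? =
  map′ (λ { (x , xs , p) → x ∷ xs , p }) (λ { (x ∷ xs , p) → x , xs , p })
       (any (λ x → anyVec? any m (λ xs → P? (x ∷ xs))))

infix 4 _↭?_

_↭?_ : B.Decidable {A = List ℕ} _↭_
xs ↭? ys = map′ to from (List.≡-dec ℕ._≟_ (sort xs) (sort ys))
  where
  open Sort ℕ.≤-decTotalOrder
  to : sort xs ≡ sort ys → xs ↭ ys
  to eq = ↭-trans (↭-sym (sort-↭ xs)) (↭-trans (↭-reflexive eq) (sort-↭ ys))
  from : xs ↭ ys → sort xs ≡ sort ys
  from p = Pointwise-≡⇒≡ (Sorted.↗↭↗⇒≋ ℕ.≤-totalOrder (sort-↗ xs) (sort-↗ ys)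
    (↭⇒↭ₛ (↭-trans (sort-↭ xs) (↭-trans p (↭-sym (sort-↭ ys))))))

-- Adjacency is decidable, as finiteness of a graph is read constructively.
record Graph : Set₁ where
  field
    order    : ℕ
    _~_      : Rel (Fin order) 0ℓ
    _~?_     : B.Decidable _~_
    ~-sym    : Symmetric _~_
    ~-irrefl : Irreflexive _≡_ _~_

  Vertex : Set
  Vertex = Fin order

  -- A path of length k visits k + 1 distinct vertices.
  IsPath : ∀ {k} → Vertex → Vertex → Vec Vertex (suc k) → Set
  IsPath u v p = head p ≡ u × last p ≡ v × Linked _~_ p × Unique p

  Path : ℕ → Vertex → Vertex → Set
  Path k u v = ∃ λ (p : Vec Vertex (suc k)) → IsPath u v p

  path? : ∀ u v → Decidable (λ k → Path k u v)
  path? u v k = anyVec? any? (suc k) λ p →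
    head p ≟ u ×-dec last p ≟ v ×-dec linked? _~?_ p
      ×-dec allPairs? (λ x y → ¬? (x ≟ y)) p

  Connected : Set
  Connected = ∀ u v → ∃ λ k → Path k u v

-- The tuple Π lists the parts S₁ , … , Sₜ; `disjoint` also makes its
-- entries pairwise distinct, as the parts are nonempty.
record IsPartition {n t : ℕ} (Π : Vec (Subset n) t) : Set where
  field
    nonempty : ∀ i → Nonempty (lookup Π i)
    cover    : ∀ v → ∃ λ i → v ∈ lookup Π i
    disjoint : ∀ i j v → v ∈ lookup Π i → v ∈ lookup Π j → i ≡ j

isPartition? : ∀ {n t} → Decidable (IsPartition {n} {t})
isPartition? Π =
  map′ (λ { (a , b , c) → record { nonempty = a ; cover = b ; disjoint = c } })
       (λ p → let open IsPartition p in nonempty , cover , disjoint)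
       (all? (λ i → nonempty? (lookup Π i))
         ×-dec all? (λ v → any? λ i → v ∈? lookup Π i)
         ×-dec all? (λ i → all? λ j → all? λ v →
                 v ∈? lookup Π i →-dec (v ∈? lookup Π j →-dec i ≟ j)))

parts≤order : ∀ {n t} {Π : Vec (Subset n) t} → IsPartition Π → t ≤ n
parts≤order {Π = Π} p = injective⇒≤ {f = rep} λ {i} {j} eq →
  disjoint i j (rep i) (proj₂ (nonempty i))
    (subst (_∈ lookup Π j) (sym eq) (proj₂ (nonempty j)))
  where
  open IsPartition p
  rep : Fin _ → Fin _
  rep i = proj₁ (nonempty i)

module Metric (G : Graph) (conn : Graph.Connected G) where
  open Graph G

  d : Vertex → Vertex → ℕ
  d u v = minimum (path? u v) (conn u v)

  -- d(v,S) for nonempty S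
  module _ (v : Vertex) (S : Subset order) where

    DistanceTo : Pred ℕ 0ℓ
    DistanceTo k = ∃ λ x → x ∈ S × k ≡ d v x

    distanceTo? : Decidable DistanceTo
    distanceTo? k = any? λ x → x ∈? S ×-dec k ℕ.≟ d v x

    dSet : Nonempty S → ℕ
    dSet (x , x∈S) = minimum distanceTo? (d v x , x , x∈S , refl)

  -- Multisets of naturals are lists up to permutation _↭_.
  rmp : ∀ {t} {Π : Vec (Subset order) t} → IsPartition Π → Vertex → List ℕ
  rmp {Π = Π} p v =
    tabulate λ i → dSet v (lookup Π i) (IsPartition.nonempty p i)

  Resolving : ∀ {t} {Π : Vec (Subset order) t} → IsPartition Π → Set
  Resolving p = ∀ u v → u ≢ v → ¬ (rmp p u ↭ rmp p v)

  IsResolvingMultisetPartition : ∀ {t} → Vec (Subset order) t → Set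
  IsResolvingMultisetPartition Π = Σ (IsPartition Π) Resolving

  HasResolvingMultisetPartition : Pred ℕ 0ℓ
  HasResolvingMultisetPartition t =
    ∃ λ (Π : Vec (Subset order) t) → IsResolvingMultisetPartition Π

  -- Whether Π is resolving does not depend on the proof that it is a partition.

  rmp-irrelevant : ∀ {t} {Π : Vec (Subset order) t} (p q : IsPartition Π) →
                   ∀ v → rmp p v ≡ rmp q v
  rmp-irrelevant {Π = Π} p q v = tabulate-cong λ i →
    minimum-irrelevant (distanceTo? v (lookup Π i)) _ _

  resolving-irrelevant : ∀ {t} {Π : Vec (Subset order) t}
                         (p q : IsPartition Π) → Resolving p → Resolving q
  resolving-irrelevant p q r u v u≢v eq = r u v u≢v
    (↭-trans (↭-reflexive (rmp-irrelevant p q u))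
      (↭-trans eq (↭-reflexive (rmp-irrelevant q p v))))

  isResolvingMultisetPartition? :
    ∀ {t} → Decidable (IsResolvingMultisetPartition {t})
  isResolvingMultisetPartition? Π with isPartition? Π
  ... | no ¬p = no (¬p ∘ proj₁)
  ... | yes p = map′ (p ,_) (λ { (q , r) → resolving-irrelevant q p r })
    (all? λ u → all? λ v → ¬? (u ≟ v) →-dec ¬? (rmp p u ↭? rmp p v))

  hasResolvingMultisetPartition? : Decidable HasResolvingMultisetPartition
  hasResolvingMultisetPartition? t =
    anyVec? anySubset? t isResolvingMultisetPartition?

  -- A partition has at most `order` parts, so this search is finite.
  anyResolvingMultisetPartition? : Dec (∃ HasResolvingMultisetPartition)
  anyResolvingMultisetPartition? =
    map′ (λ { (i , h) → toℕ i , h })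
         (λ { (t , Π , p , r) → let t<1+n = s≤s (parts≤order p) in
              fromℕ< t<1+n ,
              subst HasResolvingMultisetPartition (sym (toℕ-fromℕ< t<1+n))
                    (Π , p , r) })
         (any? {n = suc order} λ i → hasResolvingMultisetPartition? (toℕ i))

  mpd : ℕ ⁺
  mpd with anyResolvingMultisetPartition?
  ... | yes e = [ minimum hasResolvingMultisetPartition? e ]
  ... | no  _ = ⊤⁺

{-# OPTIONS --safe #-}
-- Write f v i for d(v,Sᵢ). A partition into one part gives every vertex the
-- representation {0}; into two parts, it gives {0,1} to both ends of an edge
-- between the parts. Now let there be three parts Sᵢ, Sⱼ, Sₖ, and call x ∈ Sᵢ
-- a boundary vertex of level c if it has a neighbour in Sⱼ and f x k = c, so
-- that its representation is {0,1,c}. In a resolving partition distinct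
-- boundary vertices have distinct levels. Hence there is none of level 1: its
-- neighbours in Sⱼ and Sₖ would both have level 2. From one of level c ≥ 2,
-- walk c − 1 steps towards Sₖ; the vertex w reached is adjacent to Sₖ, and has
-- level at most c, even less than c if w ∈ Sⱼ. If it has level c then w = x,
-- although f w k = 1 < f x k. So there are no boundary vertices at all, by
-- infinite descent on the level; but connectedness provides one.
module Submission where

open import Data.Empty using (⊥; ⊥-elim)
open import Data.Fin using (Fin; zero; suc; _≟_)
open import Data.Fin.Subset using (Subset; _∈_)
open import Data.List using (List; []; _∷_; map; allFin; tabulate)
open import Data.List.Membership.Propositional.Properties using (∈-allFin)
open import Data.List.Properties using (map-tabulate)
open import Data.List.Relation.Binary.Permutation.Propositional
  using (_↭_; refl; prep; swap; ↭-refl; ↭-sym; ↭-trans; ↭-reflexive; ↭⇒↭ₛ)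
open import Data.List.Relation.Binary.Permutation.Propositional.Properties
  using (map⁺; ∈-resp-↭)
import Data.List.Relation.Binary.Permutation.Setoid.Properties as Permutationₛ
import Data.List.Relation.Unary.All as Allₗ
import Data.List.Relation.Unary.AllPairs as AllPairsₗ
open import Data.List.Relation.Unary.Any using (here; there)
import Data.List.Relation.Unary.Unique.Propositional as Uniqueₗ
open import Data.List.Relation.Unary.Unique.Propositional.Properties
  using (allFin⁺)
open import Data.Nat using (ℕ; zero; suc; _+_; _≤_; _<_; z≤n; s≤s)
open import Data.Nat.Induction using (Acc; acc; <-wellFounded)
open import Data.Nat.Properties
  using (≤-refl; ≤-reflexive; ≤-trans; ≤-antisym; ≤-pred; m≤n⇒m≤1+n; +-comm;
         +-suc; +-identityʳ; +-monoʳ-≤; m≤n⇒m<n∨m≡n; n≤0⇒n≡0; n≢0⇒n>0;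
         module ≤-Reasoning)
open import Data.Product using (∃; _×_; _,_; proj₁; proj₂)
open import Data.Sum using (_⊎_; inj₁; inj₂)
open import Data.Vec using (Vec; []; _∷_; last; lookup)
open import Data.Vec.Relation.Unary.All using (All; []; _∷_)
open import Data.Vec.Relation.Unary.AllPairs using ([]; _∷_)
open import Data.Vec.Relation.Unary.Linked using (Linked; [-]; _∷_)
open import Data.Vec.Relation.Unary.Unique.Propositional using (Unique)
open import Relation.Binary.PropositionalEquality
  using (_≡_; _≢_; refl; sym; trans; cong; cong₂; subst; setoid)
open import Relation.Nullary using (yes; no; contradiction)
open import Relation.Nullary.Decidable using (decidable-stable)
open import Defs

-- Adding and removing the first vertex of a path

module _ (G : Graph) where
  open Graph G

  -- The vertices of a path are distinct, so `u` can be prepended only if `p` avoids it. If `p`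
  -- meets `u`, the rest of `p` from there on is already a path from `u`.
  avoids-or-shortcut :
    ∀ {k} u (p : Vec Vertex (suc k)) → Linked _~_ p → Unique p →
    All (u ≢_) p ⊎ ∃ λ l → l ≤ k × Path l u (last p)
  avoids-or-shortcut u (x ∷ xs) linked unique with u ≟ x
  avoids-or-shortcut u (u ∷ xs) linked unique | yes refl =
    inj₂ (_ , ≤-refl , u ∷ xs , refl , refl , linked , unique)
  avoids-or-shortcut u (x ∷ []) linked unique | no u≢x = inj₁ (u≢x ∷ [])
  avoids-or-shortcut u (x ∷ y ∷ ys) (_ ∷ linked) (_ ∷ unique) | no u≢x
    with avoids-or-shortcut u (y ∷ ys) linked unique
  ... | inj₁ u∉ys = inj₁ (u≢x ∷ u∉ys)
  ... | inj₂ (l , l≤k , q) = inj₂ (l , m≤n⇒m≤1+n l≤k , q)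

  extend : ∀ {u v x k} → u ~ v → Path k v x → ∃ λ l → l ≤ suc k × Path l u x
  extend {u} u~v (y ∷ ys , refl , refl , linked , unique)
    with avoids-or-shortcut u (y ∷ ys) linked unique
  ... | inj₁ u∉ys =
    _ , ≤-refl , u ∷ y ∷ ys , refl , refl , u~v ∷ linked , u∉ys ∷ unique
  ... | inj₂ (l , l≤k , q) = l , m≤n⇒m≤1+n l≤k , q

  unextend : ∀ {u x k} → Path (suc k) u x → ∃ λ v → u ~ v × Path k v x
  unextend (_ ∷ y ∷ ys , refl , refl , u~y ∷ linked , _ ∷ unique) =
    y , u~y , y ∷ ys , refl , refl , linked , unique

  Path-refl : ∀ u → Path 0 u u
  Path-refl u = u ∷ [] , refl , refl , [-] , [] ∷ []

  Path-0 : ∀ {u v} → Path 0 u v → u ≡ v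
  Path-0 (_ ∷ [] , refl , refl , _) = refl

-- Distances from a vertex to the parts

module PartDistances (G : Graph) (conn : Graph.Connected G) {t : ℕ}
  {Π : Vec (Subset (Graph.order G)) t} (part : IsPartition Π) where
  open Graph G
  open Metric G conn
  open IsPartition part

  -- f and δ (which is d) are opaque because the searches that define d and dSet
  -- are infeasible to normalise.
  opaque
    f : Vertex → Fin t → ℕ
    f v i = dSet v (lookup Π i) (nonempty i)

    rmp≡tabulate : ∀ v → rmp part v ≡ tabulate (f v)
    rmp≡tabulate v = refl

    f-isMinimum : ∀ v i → IsMinimum (DistanceTo v (lookup Π i)) (f v i)
    f-isMinimum v i =
      let x , x∈S = nonempty i
      in minimum-isMinimum (distanceTo? v (lookup Π i)) (d v x , x , x∈S , refl)

  opaque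
    δ : Vertex → Vertex → ℕ
    δ = d

    δ≡d : ∀ u v → δ u v ≡ d u v
    δ≡d u v = refl

    δ-isMinimum : ∀ u v → IsMinimum (λ k → Path k u v) (δ u v)
    δ-isMinimum u v = minimum-isMinimum (path? u v) (conn u v)

  opaque
    -- With `f-attained`, this merges the two nested minima, over the vertices of the part and over
    -- paths, into one over the paths from `v` into the part.
    f-minimal : ∀ {v i x k} → x ∈ lookup Π i → Path k v x → f v i ≤ k
    f-minimal {v} {i} {x} {k} x∈S q = ≤-trans
      (proj₂ (f-isMinimum v i) (δ v x) (x , x∈S , δ≡d v x))
      (proj₂ (δ-isMinimum v x) k q)

    f-attained : ∀ v i → ∃ λ x → x ∈ lookup Π i × Path (f v i) v x
    f-attained v i =
      let x , x∈S , eq = proj₁ (f-isMinimum v i)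
      in x , x∈S , subst (λ k → Path k v x)
           (trans (δ≡d v x) (sym eq)) (proj₁ (δ-isMinimum v x))

  f≡0⇒∈ : ∀ {v i} → f v i ≡ 0 → v ∈ lookup Π i
  f≡0⇒∈ {v} {i} eq with f-attained v i
  ... | x , x∈S , q with Path-0 G (subst (λ k → Path k v x) eq q)
  ... | refl = x∈S

  ∈⇒f≡0 : ∀ {v i} → v ∈ lookup Π i → f v i ≡ 0
  ∈⇒f≡0 {v} v∈S = n≤0⇒n≡0 (f-minimal v∈S (Path-refl G v))

  zero-exists : ∀ v → ∃ λ i → f v i ≡ 0
  zero-exists v with cover v
  ... | i , v∈S = i , ∈⇒f≡0 v∈S

  zero-unique : ∀ {v i j} → f v i ≡ 0 → f v j ≡ 0 → i ≡ j
  zero-unique p q = disjoint _ _ _ (f≡0⇒∈ p) (f≡0⇒∈ q)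

  positive : ∀ {v i j} → i ≢ j → f v i ≡ 0 → 1 ≤ f v j
  positive i≢j p = n≢0⇒n>0 λ q → i≢j (zero-unique p q)

  f-lipschitz : ∀ {u v} i → u ~ v → f u i ≤ suc (f v i)
  f-lipschitz {u} {v} i u~v with f-attained v i
  ... | x , x∈S , q with extend G u~v q
  ... | l , l≤ , q′ = ≤-trans (f-minimal x∈S q′) l≤

  f-descend : ∀ {v i m} → f v i ≡ suc m → ∃ λ w → v ~ w × f w i ≡ m
  f-descend {v} {i} eq with f-attained v i
  ... | x , x∈S , q with unextend G (subst (λ k → Path k v x) eq q)
  ... | w , v~w , q′ = w , v~w , ≤-antisym (f-minimal x∈S q′)
    (≤-pred (subst (_≤ suc (f w i)) eq (f-lipschitz i v~w)))

  f-across : ∀ {v w i j} → j ≢ i → v ~ w → f v i ≡ 0 → f w j ≡ 0 → f w i ≡ 1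
  f-across {w = w} {i} j≢i v~w vi wj = ≤-antisym
    (subst (λ d → f w i ≤ suc d) vi (f-lipschitz i (~-sym v~w)))
    (positive j≢i wj)

  -- Walking `m` steps of a shortest path ends one step short of part `i`; each step raises the
  -- distance to any part by at most one.
  f-approach : ∀ m {v i} → f v i ≡ suc m →
               ∃ λ w → f w i ≡ 1 × (∀ j → f w j ≤ m + f v j)
  f-approach zero eq = _ , eq , λ j → ≤-refl
  f-approach (suc m) {v} eq with f-descend eq
  ... | u , v~u , eq′ with f-approach m eq′
  ... | w , fw≡1 , w≤ = w , fw≡1 , λ j → begin
    f w j           ≤⟨ w≤ j ⟩
    m + f u j       ≤⟨ +-monoʳ-≤ m (f-lipschitz j (~-sym v~u)) ⟩
    m + suc (f v j) ≡⟨ +-suc m (f v j) ⟩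
    suc m + f v j   ∎
    where open ≤-Reasoning

  -- Lets the parts be named in any order, so that symmetric cases reuse one lemma with the roles
  -- permuted.
  Arrangement : List (Fin t) → Set
  Arrangement is = allFin t ↭ is

  Arrangement-unique : ∀ {is} → Arrangement is → Uniqueₗ.Unique is
  Arrangement-unique σ =
    Permutationₛ.Unique-resp-↭ (setoid (Fin t)) (↭⇒↭ₛ σ) (allFin⁺ t)

  rmp-arranged : ∀ v {is} → Arrangement is → rmp part v ↭ map (f v) is
  rmp-arranged v σ = ↭-trans
    (↭-reflexive (trans (rmp≡tabulate v) (sym (map-tabulate (λ i → i) (f v)))))
    (map⁺ (f v) σ)

  -- Resolving stated through the opaque f, so that it does not unfold either.
  Separating : Set
  Separating = ∀ {is js} → Arrangement is → Arrangement js →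
               ∀ {u v} → map (f u) is ≡ map (f v) js → u ≡ v

  -- `Resolving` only refutes `u ≢ v`; decidable equality of vertices turns this into `u ≡ v`.
  resolving⇒separating : Resolving part → Separating
  resolving⇒separating resolving σ τ {u} {v} eq =
    decidable-stable (u ≟ v) λ u≢v → resolving u v u≢v
      (↭-trans (rmp-arranged u σ)
        (↭-trans (↭-reflexive eq) (↭-sym (rmp-arranged v τ))))

  module _ {i j k} (σ : Arrangement (i ∷ j ∷ k ∷ [])) where

    swap₁₂ : Arrangement (j ∷ i ∷ k ∷ [])
    swap₁₂ = ↭-trans σ (swap i j ↭-refl)

    swap₂₃ : Arrangement (i ∷ k ∷ j ∷ [])
    swap₂₃ = ↭-trans σ (prep i (swap j k ↭-refl))

    distinct₁₂ : i ≢ j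
    distinct₁₂ = Allₗ.head (AllPairsₗ.head (Arrangement-unique σ))

  -- Boundary vertices among three parts

  module _ (separating : Separating) where

    module _ {i j k} (σ : Arrangement (i ∷ j ∷ k ∷ [])) where

      level-1-neighbour :
        ∀ {x} → f x i ≡ 0 → f x j ≡ 1 → f x k ≡ 1 →
        ∃ λ y → f y i ≡ 1 × f y j ≡ 0 × f y k ≡ 2
      level-1-neighbour {x} xi xj xk with f-descend xj
      ... | y , x~y , yj = y , yi , yj , yk
        where
        j≢i = distinct₁₂ (swap₁₂ σ)
        yi = f-across j≢i x~y xi yj
        y≢x : y ≢ x
        y≢x y≡x = j≢i (zero-unique (subst (λ v → f v j ≡ 0) y≡x yj) xi)
        yk : f y k ≡ 2
        yk with m≤n⇒m<n∨m≡n
          (subst (λ d → f y k ≤ suc d) xk (f-lipschitz k (~-sym x~y)))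
        ... | inj₂ yk≡2 = yk≡2
        -- Here `x` and `y` would both have the representation {0,1,1}.
        ... | inj₁ (s≤s yk≤1) = ⊥-elim (y≢x (separating (swap₁₂ σ) σ
          (cong₂ _∷_ (trans yj (sym xi)) (cong₂ _∷_ (trans yi (sym xj))
            (cong (_∷ []) (trans yk≡1 (sym xk)))))))
          where
          yk≡1 : f y k ≡ 1
          yk≡1 = ≤-antisym yk≤1 (positive (distinct₁₂ (swap₂₃ (swap₁₂ σ))) yj)

    no-level-1 : ∀ {i j k} → Arrangement (i ∷ j ∷ k ∷ []) →
                 ∀ {x} → f x i ≡ 0 → f x j ≡ 1 → f x k ≡ 1 → ⊥
    no-level-1 σ xi xj xk
      with level-1-neighbour σ xi xj xk | level-1-neighbour (swap₂₃ σ) xi xk xj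
    ... | y , yi , yj , yk | z , zi , zk , zj
      with separating σ (swap₂₃ σ) {y} {z}
        (cong₂ _∷_ (trans yi (sym zi)) (cong₂ _∷_ (trans yj (sym zk))
          (cong (_∷ []) (trans yk (sym zj)))))
    ... | refl = distinct₁₂ (swap₂₃ (swap₁₂ σ)) (zero-unique yj zk)

    -- The parts are quantified after `Acc` because each descent permutes their roles; only the
    -- level has to drop.
    no-boundary : ∀ {c} → Acc _<_ c →
                  ∀ {i j k} → Arrangement (i ∷ j ∷ k ∷ []) →
                  ∀ {x} → f x i ≡ 0 → f x j ≡ 1 → f x k ≡ c → ⊥
    no-boundary {0} _ σ xi xj xk = distinct₁₂ (swap₂₃ σ) (zero-unique xi xk)
    no-boundary {1} _ σ xi xj xk = no-level-1 σ xi xj xk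
    no-boundary {suc (suc m)} (acc lower) {i} {j} {k} σ {x} xi xj xk
      with f-approach (suc m) xk
    ... | w , wk , w≤ with zero-exists w
    ... | l , wl with ∈-resp-↭ σ (∈-allFin l)
    ... | there (there (here refl)) = contradiction (trans (sym wl) wk) λ ()
    -- `w` is in part `j` and next to part `k`, so its level is its distance to part `i`, at most
    -- `suc m` because `f x i` is 0.
    ... | there (here refl) =
      no-boundary (lower (s≤s wi≤)) (swap₂₃ (swap₁₂ σ)) wl wk refl
      where
      wi≤ : f w i ≤ suc m
      wi≤ = ≤-trans (w≤ i)
        (≤-reflexive (trans (cong (suc m +_) xi) (+-identityʳ _)))
    no-boundary {suc (suc m)} (acc lower) {i} {j} {k} σ {x} xi xj xk
      | w , wk , w≤ | l , wl | here refl
      -- `w` is in part `i`, and its level is its distance to part `j`. As `f x j` is 1, the bound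
      -- is only the old level, and equality needs its own case.
      with m≤n⇒m<n∨m≡n (≤-trans (w≤ j)
        (≤-reflexive (trans (cong (suc m +_) xj) (+-comm (suc m) 1))))
    ... | inj₁ wj< = no-boundary (lower wj<) (swap₂₃ σ) wl wk refl
    ... | inj₂ wj≡
      with separating (swap₂₃ σ) σ {w} {x}
        (cong₂ _∷_ (trans wl (sym xi)) (cong₂ _∷_ (trans wk (sym xj))
          (cong (_∷ []) (trans wj≡ (sym xk)))))
    ... | refl = contradiction (trans (sym wk) xk) λ ()

  -- The source of a boundary vertex. The walk from part `i` may cross further parts, so `w` is only
  -- known to lie outside part `j`.
  near-part : ∀ {i j} → i ≢ j → ∃ λ w → f w j ≡ 1
  near-part {i} {j} i≢j with nonempty i
  ... | v , v∈S with f v j in eq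
  ... | zero = ⊥-elim (i≢j (zero-unique (∈⇒f≡0 v∈S) eq))
  ... | suc m with f-approach m eq
  ... | w , wj , _ = w , wj

-- Excluding fewer than four parts

module _ (G : Graph) (conn : Graph.Connected G) where
  open Graph G
  open Metric G conn
  open PartDistances G conn using (resolving⇒separating)

  -- The conclusion cannot be `⊥`: a single vertex is resolved by one part. `four-parts` contradicts
  -- it with two distinct vertices.
  not-separating-1 : ∀ {Π : Vec (Subset order) 1} (part : IsPartition Π) →
                     PartDistances.Separating G conn part → ∀ {u v : Vertex} → u ≡ v
  not-separating-1 part separating {u} {v} =
    separating refl refl (cong (_∷ []) (trans (f≡0 u) (sym (f≡0 v))))
    where
    open PartDistances G conn part
    f≡0 : ∀ v → f v zero ≡ 0
    f≡0 v with zero-exists v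
    ... | zero , v0 = v0

  not-separating-2 : ∀ {Π : Vec (Subset order) 2} (part : IsPartition Π) →
                     PartDistances.Separating G conn part → ⊥
  not-separating-2 part separating = absurd
    where
    open PartDistances G conn part
    absurd : ⊥
    absurd with near-part {zero} {suc zero} (λ ())
    ... | w , w1 with zero-exists w
    ... | suc zero , w1′ = contradiction (trans (sym w1) w1′) λ ()
    ... | zero , w0 with f-descend w1
    ... | y , w~y , y1
      -- Listing the parts in swapped order for `y` makes both lists 0, 1.
      with separating (swap zero (suc zero) refl) refl {y} {w}
        (cong₂ _∷_ (trans y1 (sym w0))
          (cong (_∷ []) (trans (f-across (λ ()) w~y w0 y1) (sym w1))))
    ... | refl = contradiction (trans (sym w1) y1) λ ()

  not-separating-3 : ∀ {Π : Vec (Subset order) 3} (part : IsPartition Π) →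
                     PartDistances.Separating G conn part → ⊥
  not-separating-3 part separating = absurd
    where
    open PartDistances G conn part
    absurd : ⊥
    absurd with near-part {zero} {suc zero} (λ ())
    ... | w , w1 with zero-exists w
    ... | zero , w0 = no-boundary separating (<-wellFounded _) refl w0 w1 refl
    ... | suc zero , w1′ = contradiction (trans (sym w1) w1′) λ ()
    -- `w` lies in the third part, so the parts take the order 2, 1, 0 and the level is the distance
    -- to part 0.
    ... | suc (suc zero) , w2 =
      no-boundary separating (<-wellFounded _)
        (swap₁₂ (swap₂₃ (swap₁₂ refl))) w2 w1 refl

  four-parts : 2 ≤ order → ∀ t → HasResolvingMultisetPartition t → 4 ≤ t
  four-parts (s≤s (s≤s _)) 0 (_ , part , _) =
    contradiction (proj₁ (IsPartition.cover part zero)) λ ()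
  four-parts (s≤s (s≤s _)) 1 (_ , part , resolving) =
    contradiction
      (not-separating-1 part (resolving⇒separating part resolving) {zero} {suc zero})
      λ ()
  four-parts _ 2 (_ , part , resolving) =
    ⊥-elim (not-separating-2 part (resolving⇒separating part resolving))
  four-parts _ 3 (_ , part , resolving) =
    ⊥-elim (not-separating-3 part (resolving⇒separating part resolving))
  four-parts _ (suc (suc (suc (suc t)))) _ = s≤s (s≤s (s≤s (s≤s z≤n)))

theorem2p1 : (G : Graph) (conn : Graph.Connected G) → 2 ≤ Graph.order G → [ 4 ] ≤⁺ Metric.mpd G conn
theorem2p1 G conn 2≤n with Metric.anyResolvingMultisetPartition? G conn
... | yes e = [ four-parts G conn 2≤n _
    (proj₁ (minimum-isMinimum (Metric.hasResolvingMultisetPartition? G conn) e)) ]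
... | no _ = _ ≤⊤⁺
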